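{- For every constraint list $C$ and every substitution $\sigma$: if $\sigma\models C$, then there exists a substitution $\sigma'$ such that $\mathsf{unify}(C)=\mathsf{Some}\;\sigma'$.
   Context: Types: fix a set of type variables (with decidable equality), ranged over by $\alpha,\beta,\dots$. Types are generated by $\tau ::= \alpha \mid \tau_1 \rightarrow \tau_2$. Free variables of a type (a list): $\mathsf{FTV}(\alpha) = [\alpha]$, $\mathsf{FTV}(\tau\rightarrow\tau') = \mathsf{FTV}(\tau) \mathbin{+\!\!+} \mathsf{FTV}(\tau')$, where $+\!\!+$ is list append. "$\alpha$ occurs in $\tau$" means $\alpha\in\mathsf{FTV}(\tau)$. Constraints: a constraint is a formal equation $\tau \stackrel{\rm e}{=} \tau'$ between types; a constraint list is a finite list of constraints. Substitutions: a substitution $\sigma$ is a finite map (finite partial function) from type variables to types. $\sigma_{\mathbb{E}}$ is the empty finite map and $\{\alpha\mapsto\tau\}$ the map whose only binding sends $\alpha$ to $\tau$. Application: $\sigma(\alpha)=\tau$ if $\langle\alpha,\tau\rangle\in\sigma$, $\sigma(\alpha)=\alpha$ if $\alpha$ is not bound by $\sigma$; $\sigma(\tau_1\rightarrow\tau_2)=\sigma(\tau_1)\rightarrow\sigma(\tau_2)$; $\sigma(\tau_1\stackrel{\rm e}{=}\tau_2) = (\sigma(\tau_1)\stackrel{\rm e}{=}\sigma(\tau_2))$; and $\sigma(C)$ is obtained by applying $\sigma$ to each constraint in the list $C$. Composition: $\sigma\circ\sigma'$ is the finite map that binds $\alpha$ to $\sigma'(\tau)$ if $\langle\alpha,\tau\rangle\in\sigma$;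 binds $\alpha$ to $\tau'$ if $\alpha$ is not bound by $\sigma$ and $\langle\alpha,\tau'\rangle\in\sigma'$; and leaves $\alpha$ unbound otherwise. Satisfaction: $\sigma\models(\tau_1\stackrel{\rm e}{=}\tau_2)$ means $\sigma(\tau_1)=\sigma(\tau_2)$; $\sigma\models C$ means $\sigma$ satisfies every constraint in $C$. Unification: $\mathsf{unify}$ takes a constraint list and returns an option value: $\mathsf{None}$ indicates failure and $\mathsf{Some}\;\sigma$ indicates success with substitution $\sigma$ as the result. It is defined by (with the constructor $\mathsf{Some}$ suppressed, $\tau$ a non-variable type in the third and fourth clauses, and failure of a recursive call propagating): (1) $\mathsf{unify}([\,]) = \sigma_{\mathbb{E}}$; (2) $\mathsf{unify}((\alpha\stackrel{\rm e}{=}\beta)::C) = \mathsf{unify}(C)$ if $\alpha=\beta$, else $\{\alpha\mapsto\beta\}\circ\mathsf{unify}(\{\alpha\mapsto\beta\}(C))$; (3) $\mathsf{unify}((\alpha\stackrel{\rm e}{=}\tau)::C)$ fails if $\alpha$ occurs in $\tau$, else is $\{\alpha\mapsto\tau\}\circ\mathsf{unify}(\{\alpha\mapsto\tau\}(C))$; (4) $\mathsf{unify}((\tau\stackrel{\rm e}{=}\alpha)::C)$ fails if $\alpha$ occurs in $\tau$, else is $\{\alpha\mapsto\tau\}\circ\mathsf{unify}(\{\alpha\mapsto\tau\}(C))$; (5) $\mathsf{unify}((\tau_1\rightarrow\tau_2\stackrel{\rm e}{=}\tau_3\rightarrow\tau_4)::C) = \mathsf{unify}((\tau_1\stackrel{\rm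 e}{=}\tau_3)::(\tau_2\stackrel{\rm e}{=}\tau_4)::C)$. This is a total function by well-founded recursion on the lexicographically ordered triple (number of distinct variables in the list, total number of arrows in the list, length of the list). -}

module Defs where

open import Data.List.Base using (List; []; _∷_; _++_; length; map; concatMap; filter; deduplicate)
open import Data.List.Properties using (filter-notAll)
open import Data.List.Membership.Propositional using (_∈_; _∉_; lose)
open import Data.List.Membership.Propositional.Properties
  using (∈-++⁺ˡ; ∈-++⁺ʳ; ∈-++⁻; ∈-filter⁺; ∈-deduplicate⁺; ∈-deduplicate⁻)
import Data.List.Membership.DecPropositional as DecMembership
open import Data.List.Relation.Unary.All as All using (All; []; _∷_)
open import Data.List.Relation.Unary.All.Properties using (¬Any⇒All¬)
open import Data.List.Relation.Unary.AllPairs using ([]; _∷_)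
open import Data.List.Relation.Unary.Any using (here; there)
open import Data.List.Relation.Unary.Unique.Propositional using (Unique)
import Data.List.Relation.Unary.Unique.DecPropositional.Properties as DecUnique
open import Data.List.Relation.Binary.Subset.Propositional using (_⊆_)
open import Data.List.Relation.Binary.Subset.Propositional.Properties using (xs⊆ys++xs)
open import Data.Maybe.Base as Maybe using (Maybe; just; nothing; fromMaybe)
open import Data.Nat.Base using (ℕ; suc; _+_; _≤_; _<_; z≤n; s≤s)
open import Data.Nat.Properties using (≤-trans; m≤n⇒m<n∨m≡n; n<1+n; m<n⇒m<1+n)
open import Data.Nat.Induction using (<-wellFounded)
open import Data.Nat.ListAction using (sum)
open import Data.Nat.Tactic.RingSolver using (solve-∀)
open import Data.Product.Base using (_×_; _,_; proj₁)
open import Data.Product.Relation.Binary.Lex.Strict using (×-Lex; ×-wellFounded)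
open import Data.Sum.Base using (_⊎_; inj₁; inj₂)
open import Function.Base using (_on_; _∘_)
open import Induction.WellFounded using (Acc; acc; WellFounded; module Subrelation)
open import Relation.Binary.Definitions using (DecidableEquality)
open import Relation.Binary.PropositionalEquality using (_≡_; _≢_; refl; subst)
import Relation.Binary.Construct.On as On
open import Relation.Nullary using (yes; no; ¬?)

module Unification {a} {Var : Set a} (_≟_ : DecidableEquality Var) where

  open DecMembership _≟_ using (_∈?_)

  infixr 6 _⇒_
  infix  5 _≐_
  infix  4 _⊨ᶜ_ _⊨_ _≺_
  infixr 9 _∘ˢ_

  data Type : Set a where
    var : Var → Type
    _⇒_ : Type → Type → Type

  FTV : Type → List Var
  FTV (var α)   = α ∷ []
  FTV (τ₁ ⇒ τ₂) = FTV τ₁ ++ FTV τ₂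

  data Constraint : Set a where
    _≐_ : Type → Type → Constraint

  -- A finite partial function; `support` may list more variables than
  -- are actually bound.
  record Substitution : Set a where
    field
      lookup        : Var → Maybe Type
      support       : List Var
      bound⇒support : ∀ {α τ} → lookup α ≡ just τ → α ∈ support

  open Substitution

  σ𝔼 : Substitution
  σ𝔼 .lookup _         = nothing
  σ𝔼 .support          = []
  σ𝔼 .bound⇒support ()

  [_↦_] : Var → Type → Substitution
  [ α ↦ τ ] .lookup β with β ≟ α
  ... | yes _ = just τ
  ... | no  _ = nothing
  [ α ↦ τ ] .support = α ∷ []
  [ α ↦ τ ] .bound⇒support {β} eq with β ≟ α
  ... | yes β≡α = here β≡α

  apply : Substitution → Type → Type
  apply σ (var α)   = fromMaybe (var α) (lookup σ α)
  apply σ (τ₁ ⇒ τ₂) = apply σ τ₁ ⇒ apply σ τ₂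

  applyᶜ : Substitution → Constraint → Constraint
  applyᶜ σ (τ₁ ≐ τ₂) = apply σ τ₁ ≐ apply σ τ₂

  applyᴸ : Substitution → List Constraint → List Constraint
  applyᴸ σ = map (applyᶜ σ)

  -- Composition in diagrammatic order: σ acts first, then σ′.
  _∘ˢ_ : Substitution → Substitution → Substitution
  (σ ∘ˢ σ′) .lookup α with lookup σ α
  ... | just τ  = just (apply σ′ τ)
  ... | nothing = lookup σ′ α
  (σ ∘ˢ σ′) .support = support σ ++ support σ′
  (σ ∘ˢ σ′) .bound⇒support {α} eq with lookup σ α in eqσ
  ... | just _  = ∈-++⁺ˡ (bound⇒support σ eqσ)
  ... | nothing = ∈-++⁺ʳ (support σ) (bound⇒support σ′ eq)

  _⊨ᶜ_ : Substitution → Constraint → Set a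
  σ ⊨ᶜ (τ₁ ≐ τ₂) = apply σ τ₁ ≡ apply σ τ₂

  _⊨_ : Substitution → List Constraint → Set a
  σ ⊨ C = All (σ ⊨ᶜ_) C

  FTVᶜ : Constraint → List Var
  FTVᶜ (τ₁ ≐ τ₂) = FTV τ₁ ++ FTV τ₂

  FTVᴸ : List Constraint → List Var
  FTVᴸ = concatMap FTVᶜ

  arrows : Type → ℕ
  arrows (var _)   = 0
  arrows (τ₁ ⇒ τ₂) = suc (arrows τ₁ + arrows τ₂)

  arrowsᶜ : Constraint → ℕ
  arrowsᶜ (τ₁ ≐ τ₂) = arrows τ₁ + arrows τ₂

  #vars : List Constraint → ℕ
  #vars C = length (deduplicate _≟_ (FTVᴸ C))

  #arrows : List Constraint → ℕ
  #arrows C = sum (map arrowsᶜ C)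

  measure : List Constraint → ℕ × ℕ × ℕ
  measure C = #vars C , #arrows C , length C

  -- A record rather than a synonym: unfolding it would expose the equality
  -- tests inside `deduplicate` to the with-abstractions of `unifyAcc`.
  record _≺_ (C D : List Constraint) : Set a where
    constructor decreases
    field
      lex : (×-Lex _≡_ _<_ (×-Lex _≡_ _<_ _<_) on measure) C D

  ≺-wellFounded : WellFounded _≺_
  ≺-wellFounded = Subrelation.wellFounded _≺_.lex (On.wellFounded measure
    (×-wellFounded <-wellFounded (×-wellFounded <-wellFounded <-wellFounded)))

  Unique-⊆⇒length≤ : ∀ {xs ys : List Var} → Unique xs → xs ⊆ ys → length xs ≤ length ys
  Unique-⊆⇒length≤ []          _     = z≤n
  Unique-⊆⇒length≤ {x ∷ xs} {ys} (x∉xs ∷ u) xs⊆ys = ≤-trans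
    (s≤s (Unique-⊆⇒length≤ u λ z∈xs →
      ∈-filter⁺ (¬? ∘ (x ≟_)) (xs⊆ys (there z∈xs)) (All.lookup x∉xs z∈xs)))
    (filter-notAll (¬? ∘ (x ≟_)) ys (lose (xs⊆ys (here refl)) λ x≢x → x≢x refl))

  #vars-mono-≤ : ∀ C D → FTVᴸ C ⊆ FTVᴸ D → #vars C ≤ #vars D
  #vars-mono-≤ C D C⊆D = Unique-⊆⇒length≤ (DecUnique.deduplicate-! _≟_ (FTVᴸ C))
    (∈-deduplicate⁺ _≟_ ∘ C⊆D ∘ ∈-deduplicate⁻ _≟_ (FTVᴸ C))

  #vars-mono-< : ∀ C D {α} → FTVᴸ C ⊆ FTVᴸ D → α ∈ FTVᴸ D → α ∉ FTVᴸ C → #vars C < #vars D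
  #vars-mono-< C D C⊆D α∈D α∉C = Unique-⊆⇒length≤
    (¬Any⇒All¬ _ (α∉C ∘ ∈-deduplicate⁻ _≟_ (FTVᴸ C)) ∷ DecUnique.deduplicate-! _≟_ (FTVᴸ C))
    λ { (here refl) → ∈-deduplicate⁺ _≟_ α∈D
      ; (there z∈)  → ∈-deduplicate⁺ _≟_ (C⊆D (∈-deduplicate⁻ _≟_ (FTVᴸ C) z∈)) }

  ≺-⊆ : ∀ C D → FTVᴸ C ⊆ FTVᴸ D →
        ×-Lex _≡_ _<_ _<_ (#arrows C , length C) (#arrows D , length D) → C ≺ D
  ≺-⊆ C D C⊆D lt with m≤n⇒m<n∨m≡n (#vars-mono-≤ C D C⊆D)
  ... | inj₁ fewer = decreases (inj₁ fewer)
  ... | inj₂ same  = decreases (inj₂ (same , lt))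

  FTV-apply : ∀ {α τ} → α ∉ FTV τ → ∀ υ {β} → β ∈ FTV (apply [ α ↦ τ ] υ) →
              β ≢ α × (β ∈ FTV τ ⊎ β ∈ FTV υ)
  FTV-apply {α} {τ} α∉τ (var γ) {β} β∈ with γ ≟ α
  ... | yes _ = (λ { refl → α∉τ β∈ }) , inj₁ β∈
  FTV-apply {α} α∉τ (var γ) (here refl) | no γ≢α = γ≢α , inj₂ (here refl)
  FTV-apply {α} {τ} α∉τ (υ₁ ⇒ υ₂) β∈ with ∈-++⁻ (FTV (apply [ α ↦ τ ] υ₁)) β∈
  ... | inj₁ p with FTV-apply α∉τ υ₁ p
  ...   | β≢α , inj₁ q = β≢α , inj₁ q
  ...   | β≢α , inj₂ q = β≢α , inj₂ (∈-++⁺ˡ q)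
  FTV-apply {α} {τ} α∉τ (υ₁ ⇒ υ₂) β∈ | inj₂ p with FTV-apply α∉τ υ₂ p
  ...   | β≢α , inj₁ q = β≢α , inj₁ q
  ...   | β≢α , inj₂ q = β≢α , inj₂ (∈-++⁺ʳ (FTV υ₁) q)

  -- FTVᶜ (υ₁ ≐ υ₂) and FTV (υ₁ ⇒ υ₂) are definitionally equal.
  FTV-applyᴸ : ∀ {α τ} → α ∉ FTV τ → ∀ C {β} → β ∈ FTVᴸ (applyᴸ [ α ↦ τ ] C) →
               β ≢ α × (β ∈ FTV τ ⊎ β ∈ FTVᴸ C)
  FTV-applyᴸ {α} {τ} α∉τ ((υ₁ ≐ υ₂) ∷ C) β∈
    with ∈-++⁻ (FTV (apply [ α ↦ τ ] (υ₁ ⇒ υ₂))) β∈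
  ... | inj₁ p with FTV-apply α∉τ (υ₁ ⇒ υ₂) p
  ...   | β≢α , inj₁ q = β≢α , inj₁ q
  ...   | β≢α , inj₂ q = β≢α , inj₂ (∈-++⁺ˡ q)
  FTV-applyᴸ {α} {τ} α∉τ ((υ₁ ≐ υ₂) ∷ C) β∈ | inj₂ p with FTV-applyᴸ α∉τ C p
  ...   | β≢α , inj₁ q = β≢α , inj₁ q
  ...   | β≢α , inj₂ q = β≢α , inj₂ (∈-++⁺ʳ (FTV (υ₁ ⇒ υ₂)) q)

  ≺-tail : ∀ α C → C ≺ (var α ≐ var α) ∷ C
  ≺-tail α C = ≺-⊆ C ((var α ≐ var α) ∷ C) (xs⊆ys++xs (FTVᴸ C) _) (inj₂ (refl , n<1+n _))

  ≺-elimˡ : ∀ {α τ} → α ∉ FTV τ → ∀ C → applyᴸ [ α ↦ τ ] C ≺ (var α ≐ τ) ∷ C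
  ≺-elimˡ {α} {τ} α∉τ C = decreases (inj₁ (#vars-mono-< (applyᴸ [ α ↦ τ ] C) ((var α ≐ τ) ∷ C)
    sub (here refl) λ α∈ → proj₁ (FTV-applyᴸ α∉τ C α∈) refl))
    where
    sub : FTVᴸ (applyᴸ [ α ↦ τ ] C) ⊆ FTVᴸ ((var α ≐ τ) ∷ C)
    sub β∈ with FTV-applyᴸ α∉τ C β∈
    ... | _ , inj₁ q = there (∈-++⁺ˡ q)
    ... | _ , inj₂ q = there (∈-++⁺ʳ (FTV τ) q)

  ≺-elimʳ : ∀ {α τ} → α ∉ FTV τ → ∀ C → applyᴸ [ α ↦ τ ] C ≺ (τ ≐ var α) ∷ C
  ≺-elimʳ {α} {τ} α∉τ C = decreases (inj₁ (#vars-mono-< (applyᴸ [ α ↦ τ ] C) ((τ ≐ var α) ∷ C)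
    sub (∈-++⁺ˡ (∈-++⁺ʳ (FTV τ) (here refl)))
    λ α∈ → proj₁ (FTV-applyᴸ α∉τ C α∈) refl))
    where
    sub : FTVᴸ (applyᴸ [ α ↦ τ ] C) ⊆ FTVᴸ ((τ ≐ var α) ∷ C)
    sub β∈ with FTV-applyᴸ α∉τ C β∈
    ... | _ , inj₁ q = ∈-++⁺ˡ (∈-++⁺ˡ q)
    ... | _ , inj₂ q = ∈-++⁺ʳ (FTV τ ++ α ∷ []) q

  ≺-decompose : ∀ τ₁ τ₂ τ₃ τ₄ C →
    (τ₁ ≐ τ₃) ∷ (τ₂ ≐ τ₄) ∷ C ≺ (τ₁ ⇒ τ₂ ≐ τ₃ ⇒ τ₄) ∷ C
  ≺-decompose τ₁ τ₂ τ₃ τ₄ C = ≺-⊆ ((τ₁ ≐ τ₃) ∷ (τ₂ ≐ τ₄) ∷ C) ((τ₁ ⇒ τ₂ ≐ τ₃ ⇒ τ₄) ∷ C) sub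
    (inj₁ (subst (suc (#arrows ((τ₁ ≐ τ₃) ∷ (τ₂ ≐ τ₄) ∷ C)) ≤_)
      (count (arrows τ₁) (arrows τ₂) (arrows τ₃) (arrows τ₄) (#arrows C))
      (m<n⇒m<1+n (n<1+n _))))
    where
    count : ∀ a b c d e → 2 + ((a + c) + ((b + d) + e)) ≡ (suc (a + b) + suc (c + d)) + e
    count = solve-∀

    sub : FTVᴸ ((τ₁ ≐ τ₃) ∷ (τ₂ ≐ τ₄) ∷ C) ⊆ FTVᴸ ((τ₁ ⇒ τ₂ ≐ τ₃ ⇒ τ₄) ∷ C)
    sub β∈ with ∈-++⁻ (FTV τ₁ ++ FTV τ₃) β∈
    sub β∈ | inj₁ p with ∈-++⁻ (FTV τ₁) p
    ... | inj₁ q = ∈-++⁺ˡ (∈-++⁺ˡ (∈-++⁺ˡ q))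
    ... | inj₂ q = ∈-++⁺ˡ (∈-++⁺ʳ (FTV τ₁ ++ FTV τ₂) (∈-++⁺ˡ q))
    sub β∈ | inj₂ p with ∈-++⁻ (FTV τ₂ ++ FTV τ₄) p
    ... | inj₂ q = ∈-++⁺ʳ (FTV (τ₁ ⇒ τ₂) ++ FTV (τ₃ ⇒ τ₄)) q
    ... | inj₁ q with ∈-++⁻ (FTV τ₂) q
    ...   | inj₁ r = ∈-++⁺ˡ (∈-++⁺ˡ (∈-++⁺ʳ (FTV τ₁) r))
    ...   | inj₂ r = ∈-++⁺ˡ (∈-++⁺ʳ (FTV τ₁ ++ FTV τ₂) (∈-++⁺ʳ (FTV τ₃) r))

  var-∉ : ∀ {α β} → α ≢ β → α ∉ FTV (var β)
  var-∉ α≢β (here α≡β) = α≢β α≡β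

  unifyAcc : (C : List Constraint) → Acc _≺_ C → Maybe Substitution
  unifyAcc [] _ = just σ𝔼
  unifyAcc ((var α ≐ var β) ∷ C) (acc rs) with α ≟ β
  ... | yes refl = unifyAcc C (rs (≺-tail α C))
  ... | no  α≢β  = Maybe.map ([ α ↦ var β ] ∘ˢ_)
                     (unifyAcc (applyᴸ [ α ↦ var β ] C) (rs (≺-elimˡ (var-∉ α≢β) C)))
  unifyAcc ((var α ≐ τ@(_ ⇒ _)) ∷ C) (acc rs) with α ∈? FTV τ
  ... | yes _   = nothing
  ... | no  α∉τ = Maybe.map ([ α ↦ τ ] ∘ˢ_)
                    (unifyAcc (applyᴸ [ α ↦ τ ] C) (rs (≺-elimˡ α∉τ C)))
  unifyAcc ((τ@(_ ⇒ _) ≐ var α) ∷ C) (acc rs) with α ∈? FTV τ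
  ... | yes _   = nothing
  ... | no  α∉τ = Maybe.map ([ α ↦ τ ] ∘ˢ_)
                    (unifyAcc (applyᴸ [ α ↦ τ ] C) (rs (≺-elimʳ α∉τ C)))
  unifyAcc ((τ₁ ⇒ τ₂ ≐ τ₃ ⇒ τ₄) ∷ C) (acc rs) =
    unifyAcc ((τ₁ ≐ τ₃) ∷ (τ₂ ≐ τ₄) ∷ C) (rs (≺-decompose τ₁ τ₂ τ₃ τ₄ C))

  unify : List Constraint → Maybe Substitution
  unify C = unifyAcc C (≺-wellFounded C)

{-# OPTIONS --safe #-}
-- A unifier σ of α ≐ τ satisfies σ ∘ {α ↦ τ} = σ on types, so the same σ solves
-- every recursive call and no recursive call fails.  The occurs check cannot fire
-- on a solvable constraint: if α occurs in an arrow type τ, then σ(τ) has strictly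
-- more arrows than σ(α).
module Submission where

open import Defs
open import Data.List.Base using (List; []; _∷_)
open import Data.List.Membership.Propositional using (_∈_)
open import Data.List.Membership.Propositional.Properties using (∈-++⁻)
import Data.List.Membership.DecPropositional as DecMembership
open import Data.List.Relation.Unary.All as All using ([]; _∷_)
open import Data.List.Relation.Unary.All.Properties using (map⁺)
open import Data.List.Relation.Unary.Any using (here)
open import Data.Maybe.Base as Maybe using (Maybe; just)
open import Data.Nat.Base using (_≤_; _<_; s≤s)
open import Data.Nat.Properties
  using (≤-refl; ≤-trans; m≤m+n; m≤n+m; <⇒≤; <-irrefl)
open import Data.Product.Base using (_,_; ∃-syntax)
open import Data.Sum.Base using (inj₁; inj₂)
open import Function.Base using (_∘_)
open import Induction.WellFounded using (Acc; acc)
open import Relation.Binary.Definitions using (DecidableEquality)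
open import Relation.Binary.PropositionalEquality
  using (_≡_; _≢_; refl; sym; trans; cong; cong₂)
open import Relation.Nullary using (yes; no; contradiction)

-- The elimination clauses of `unifyAcc` only compose onto the recursive result, so success of the
-- recursive call carries over.
map-just : ∀ {a b} {A : Set a} {B : Set b} (f : A → B) {m : Maybe A} →
           ∃[ x ] m ≡ just x → ∃[ y ] Maybe.map f m ≡ just y
map-just f (x , refl) = f x , refl

module _ {a} {Var : Set a} (_≟_ : DecidableEquality Var) where

  open Unification _≟_
  open DecMembership _≟_ using (_∈?_)

  ⇒-injectiveˡ : ∀ {τ₁ τ₂ τ₃ τ₄ : Type} → τ₁ ⇒ τ₂ ≡ τ₃ ⇒ τ₄ → τ₁ ≡ τ₃
  ⇒-injectiveˡ refl = refl

  ⇒-injectiveʳ : ∀ {τ₁ τ₂ τ₃ τ₄ : Type} → τ₁ ⇒ τ₂ ≡ τ₃ ⇒ τ₄ → τ₂ ≡ τ₄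
  ⇒-injectiveʳ refl = refl

  -- Proved mutually with the strict bound: a component of an arrow type may be `var α` itself, so
  -- only `≤` is available there.
  arrows-apply-≤ : ∀ σ {α} τ → α ∈ FTV τ →
                   arrows (apply σ (var α)) ≤ arrows (apply σ τ)
  arrows-apply-< : ∀ σ {α} τ₁ τ₂ → α ∈ FTV (τ₁ ⇒ τ₂) →
                   arrows (apply σ (var α)) < arrows (apply σ (τ₁ ⇒ τ₂))

  arrows-apply-≤ σ (var _)   (here refl) = ≤-refl
  arrows-apply-≤ σ (τ₁ ⇒ τ₂) α∈ = <⇒≤ (arrows-apply-< σ τ₁ τ₂ α∈)

  arrows-apply-< σ τ₁ τ₂ α∈ with ∈-++⁻ (FTV τ₁) α∈
  -- The root arrow supplies the `suc` that makes the bound strict.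
  ... | inj₁ p = s≤s (≤-trans (arrows-apply-≤ σ τ₁ p) (m≤m+n _ _))
  ... | inj₂ p = s≤s (≤-trans (arrows-apply-≤ σ τ₂ p) (m≤n+m _ _))

  occurs⇒≢ : ∀ σ {α} τ₁ τ₂ → α ∈ FTV (τ₁ ⇒ τ₂) →
             apply σ (var α) ≢ apply σ (τ₁ ⇒ τ₂)
  occurs⇒≢ σ τ₁ τ₂ α∈ eq = <-irrefl (cong arrows eq) (arrows-apply-< σ τ₁ τ₂ α∈)

  -- The inner substitution changes only the leaves `var α`, and at such a leaf the claim is the
  -- hypothesis reversed.
  apply-absorbs : ∀ σ {α τ} → apply σ (var α) ≡ apply σ τ →
                  ∀ υ → apply σ (apply [ α ↦ τ ] υ) ≡ apply σ υ
  apply-absorbs σ {α} eq (var γ) with γ ≟ α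
  ... | yes refl = sym eq
  ... | no  _    = refl
  apply-absorbs σ eq (υ₁ ⇒ υ₂) = cong₂ _⇒_ (apply-absorbs σ eq υ₁) (apply-absorbs σ eq υ₂)

  ⊨-applyᴸ : ∀ σ {α τ} → apply σ (var α) ≡ apply σ τ →
             ∀ {C} → σ ⊨ C → σ ⊨ applyᴸ [ α ↦ τ ] C
  ⊨-applyᴸ σ {α} {τ} eq = map⁺ ∘ All.map λ {c} → step c
    where
    step : ∀ c → σ ⊨ᶜ c → σ ⊨ᶜ applyᶜ [ α ↦ τ ] c
    step (υ₁ ≐ υ₂) p =
      trans (apply-absorbs σ eq υ₁) (trans p (sym (apply-absorbs σ eq υ₂)))

  -- Quantifying over every accessibility proof lets the induction follow the recursion of
  -- `unifyAcc`, whatever proof `rs` returns.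
  unifyAcc-complete : ∀ σ C (rec : Acc _≺_ C) → σ ⊨ C → ∃[ σ′ ] unifyAcc C rec ≡ just σ′
  unifyAcc-complete σ [] _ [] = σ𝔼 , refl
  unifyAcc-complete σ ((var α ≐ var β) ∷ C) (acc rs) (p ∷ ps) with α ≟ β
  ... | yes refl = unifyAcc-complete σ C _ ps
  ... | no  _    = map-just _ (unifyAcc-complete σ _ _ (⊨-applyᴸ σ p ps))
  unifyAcc-complete σ ((var α ≐ τ@(τ₁ ⇒ τ₂)) ∷ C) (acc rs) (p ∷ ps) with α ∈? FTV τ
  ... | yes α∈τ = contradiction p (occurs⇒≢ σ τ₁ τ₂ α∈τ)
  ... | no  _   = map-just _ (unifyAcc-complete σ _ _ (⊨-applyᴸ σ p ps))
  unifyAcc-complete σ ((τ@(τ₁ ⇒ τ₂) ≐ var α) ∷ C) (acc rs) (p ∷ ps) with α ∈? FTV τ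
  ... | yes α∈τ = contradiction (sym p) (occurs⇒≢ σ τ₁ τ₂ α∈τ)
  -- The variable is on the right here, while absorption expects it on the left.
  ... | no  _   = map-just _ (unifyAcc-complete σ _ _ (⊨-applyᴸ σ (sym p) ps))
  unifyAcc-complete σ ((τ₁ ⇒ τ₂ ≐ τ₃ ⇒ τ₄) ∷ C) (acc rs) (p ∷ ps) =
    -- `apply` computes through `⇒`, so `p` equates two arrow types and splits by injectivity.
    unifyAcc-complete σ ((τ₁ ≐ τ₃) ∷ (τ₂ ≐ τ₄) ∷ C) _ (⇒-injectiveˡ p ∷ ⇒-injectiveʳ p ∷ ps)

theorem5 : ∀ {a} {Var : Set a} (_≟_ : DecidableEquality Var) → let open Unification _≟_ in
    (C : List Constraint) (σ : Substitution) → σ ⊨ C → ∃[ σ′ ] unify C ≡ just σ′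
theorem5 _≟_ C σ = unifyAcc-complete _≟_ σ C (≺-wellFounded C)
  where open Unification _≟_
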